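{- There is an absolute constant $C$ such that for all integers $n \ge 7$, $\mathrm{sat}^*(n,K_4) \le \frac{7}{2}n + C$ (that is, $\mathrm{sat}^*(n,K_4)\le\frac72 n+O(1)$).
   Context: All graphs are finite and simple. An edge-colouring of a graph is proper if incident edges receive different colours, and a subgraph is rainbow if all of its edges receive pairwise distinct colours. A graph $G$ is properly rainbow $H$-saturated if (1) there is a proper edge-colouring of $G$ (with any set of colours) containing no rainbow copy of $H$, and (2) for every edge $e$ of the complement $\overline{G}$, every proper edge-colouring of $G+e$ contains a rainbow copy of $H$. The proper rainbow saturation number $\mathrm{sat}^*(n,H)$ is the minimum number of edges in an $n$-vertex properly rainbow $H$-saturated graph. -}

module Defs where

open import Data.Bool using (Bool; true; false; _∨_; _∧_; not; T)
open import Data.Bool.Properties using (∨-comm; ∧-comm; T?)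
open import Data.Empty using (⊥-elim)
open import Data.Fin using (Fin; _≟_; _<?_)
open import Data.List using (List; length; filter; allFin; cartesianProduct)
open import Data.Nat using (ℕ; _≤_)
open import Data.Product using (∃; _×_; _,_)
open import Data.Sum using (_⊎_)
open import Function.Definitions using (Injective)
open import Relation.Nullary using (¬_; yes; no)
open import Relation.Nullary.Decidable using (⌊_⌋; _×-dec_)
open import Relation.Binary.PropositionalEquality using (_≡_; _≢_; refl; sym; cong)

record Graph (n : ℕ) : Set where
  field
    adj        : Fin n → Fin n → Bool
    adj-sym    : ∀ x y → adj x y ≡ adj y x
    adj-irrefl : ∀ x → adj x x ≡ false

  Adj : Fin n → Fin n → Set
  Adj x y = T (adj x y)

open Graph public

-- Each edge {x, y} is listed once, as the pair with x < y.
edges : ∀ {n} → Graph n → List (Fin n × Fin n)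
edges {n} G =
  filter (λ (x , y) → (x <? y) ×-dec T? (adj G x y))
         (cartesianProduct (allFin n) (allFin n))

numEdges : ∀ {n} → Graph n → ℕ
numEdges G = length (edges G)

≟-sym : ∀ {n} (x y : Fin n) → ⌊ x ≟ y ⌋ ≡ ⌊ y ≟ x ⌋
≟-sym x y with x ≟ y | y ≟ x
... | yes _ | yes _ = refl
... | no  _ | no  _ = refl
... | yes p | no  q = ⊥-elim (q (sym p))
... | no  p | yes q = ⊥-elim (p (sym q))

K : (k : ℕ) → Graph k
K k = record
  { adj        = λ x y → not ⌊ x ≟ y ⌋
  ; adj-sym    = λ x y → cong not (≟-sym x y)
  ; adj-irrefl = irr
  }
  where
  irr : ∀ x → not ⌊ x ≟ x ⌋ ≡ false
  irr x with x ≟ x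
  ... | yes _ = refl
  ... | no  q = ⊥-elim (q refl)

addEdge : ∀ {n} (G : Graph n) (u v : Fin n) → u ≢ v → Graph n
addEdge G u v u≢v = record
  { adj        = λ x y → adj G x y ∨ (is x u ∧ is y v ∨ is x v ∧ is y u)
  ; adj-sym    = symm
  ; adj-irrefl = irr
  }
  where
  is : _ → _ → Bool
  is x y = ⌊ x ≟ y ⌋

  symm : ∀ x y → adj G x y ∨ (is x u ∧ is y v ∨ is x v ∧ is y u)
               ≡ adj G y x ∨ (is y u ∧ is x v ∨ is y v ∧ is x u)
  symm x y rewrite adj-sym G x y
                 | ∧-comm (is x u) (is y v)
                 | ∧-comm (is x v) (is y u)
                 | ∨-comm (is y v ∧ is x u) (is y u ∧ is x v) = refl

  irr : ∀ x → adj G x x ∨ (is x u ∧ is x v ∨ is x v ∧ is x u) ≡ false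
  irr x rewrite adj-irrefl G x with x ≟ u | x ≟ v
  ... | yes refl | yes refl = ⊥-elim (u≢v refl)
  ... | yes _    | no  _    = refl
  ... | no  _    | yes _    = refl
  ... | no  _    | no  _    = refl

-- An edge-colouring is a symmetric function of the two endpoints.  It is total
-- on pairs of vertices, but every notion below only consults it on edges.
-- A finite graph uses finitely many colours, so ℕ serves as the universe
-- of colours; no bound is put on the number of colours used.
record Colouring (n : ℕ) : Set where
  field
    colour     : Fin n → Fin n → ℕ
    colour-sym : ∀ x y → colour x y ≡ colour y x

open Colouring public

Proper : ∀ {n} → Graph n → Colouring n → Set
Proper G c = ∀ x y z → Adj G x y → Adj G x z → y ≢ z →
             colour c x y ≢ colour c x z

SameEdge : ∀ {n} → Fin n → Fin n → Fin n → Fin n → Set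
SameEdge a b a′ b′ = (a ≡ a′ × b ≡ b′) ⊎ (a ≡ b′ × b ≡ a′)

-- A (not necessarily induced) copy of H in G, all of whose edges receive
-- pairwise distinct colours.
record RainbowCopy {k n} (H : Graph k) (G : Graph n) (c : Colouring n) : Set where
  field
    embed     : Fin k → Fin n
    injective : Injective _≡_ _≡_ embed
    preserves : ∀ a b → Adj H a b → Adj G (embed a) (embed b)
    rainbow   : ∀ a b a′ b′ → Adj H a b → Adj H a′ b′ → ¬ SameEdge a b a′ b′ →
                colour c (embed a) (embed b) ≢ colour c (embed a′) (embed b′)

record ProperlyRainbowSaturated {k n} (H : Graph k) (G : Graph n) : Set where
  field
    rainbow-free : ∃ λ c → Proper G c × ¬ RainbowCopy H G c
    maximal      : ∀ u v (u≢v : u ≢ v) → ¬ Adj G u v →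
                   ∀ c → Proper (addEdge G u v u≢v) c →
                   RainbowCopy H (addEdge G u v u≢v) c

-- IsSat* n H m says that sat*(n, H), defined as a minimum, exists and equals m.
record IsSat* {k} (n : ℕ) (H : Graph k) (m : ℕ) : Set where
  field
    attained : ∃ λ (G : Graph n) → ProperlyRainbowSaturated H G × numEdges G ≡ m
    minimal  : ∀ (G : Graph n) → ProperlyRainbowSaturated H G → m ≤ numEdges G

module Submission where

-- Cover all but the two hub vertices 0 and 1 by consecutive blocks of four
-- vertices (the last one possibly smaller), and let every block together with
-- the hubs span a complete graph: these are K₆'s sharing an edge, with 14 edges
-- for every 4 vertices.  Colouring each K₆ by its 1-factorisation, with the
-- shared edge in the common colour, leaves no rainbow K₄.  Conversely, in any
-- proper colouring of a K₆ without a rainbow K₄ all colour classes are perfect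
-- matchings.  So if an outside vertex v is joined to three vertices of the K₆
-- (the hubs and the end of an added edge), the edges from v use colours foreign
-- to the K₆ and form a rainbow K₄ with those three.  Constructively, the minimum in
-- sat* exists because saturation is decidable.

open import Data.Bool using (Bool; false; _∨_; _∧_; not; T; if_then_else_)
open import Data.Bool.Properties using (∧-comm; ∧-idem; ∧-zeroʳ; ∧-identityʳ; T?; T-∨; T-∧)
open import Data.Fin
  using (Fin; zero; suc; toℕ; fromℕ<; _≟_; _<?_; combine; remQuot; finToFun; funToFin)
open import Data.Fin.Patterns using (0F; 1F; 2F; 3F)
open import Data.Fin.Properties as Finₚ
  using (any?; all?; toℕ-injective; toℕ-fromℕ<; toℕ<n; injective⇒≤; remQuot-combine;
        finToFun-funToFin; 2↔Bool)
open import Data.Integer as ℤ using (+_)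
import Data.Integer.Properties as ℤₚ
open import Data.List
  using (List; []; _∷_; length; map; upTo; allFin; filter; cartesianProduct; lookup)
open import Data.List.Membership.Propositional using (_∈_)
open import Data.List.Membership.Propositional.Properties
  using (∈-map⁺; ∈-map⁻; ∈-filter⁺; ∈-filter⁻; ∈-cartesianProduct⁺; ∈-upTo⁺; ∈-allFin; ∈-lookup)
open import Data.List.Properties using (filter-≐; length-map; length-upTo; length-++)
open import Data.List.Relation.Binary.Subset.Propositional using (_⊆_)
open import Data.List.Relation.Unary.All as All using ([]; _∷_)
open import Data.List.Relation.Unary.AllPairs using ([]; _∷_)
open import Data.List.Relation.Unary.Any as Any using (Any; here; there; index)
open import Data.List.Relation.Unary.Any.Properties using (lookup-index)
open import Data.List.Relation.Unary.Unique.Propositional using (Unique)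
import Data.List.Relation.Unary.Unique.Propositional.Properties as Unique
open import Data.Nat as ℕ using (ℕ; _+_; _*_; _^_; _⊔_; _≤_; _<_; _≥_; z≤n; s≤s; z<s)
open import Data.Nat.DivMod using (_/_; _mod_; /-monoˡ-≤; m*n/n≡m; m/n*n≤m)
open import Data.Nat.Induction using (<-rec)
open import Data.Nat.Properties
  using (⊔-comm; ⊔-idem; anyUpTo?; ≮⇒≥; <⇒≤; ≤-refl; ≤-trans; <-irrefl; <-trans; ≤-<-trans;
        <-≤-trans; <-cmp; <⇒≱; <⇒≢; m≤m+n; m≤n+m; +-mono-≤; +-mono-<-≤; +-mono-≤-<; +-mono-<;
        +-monoʳ-<; +-monoˡ-≤; *-monoˡ-≤; *-monoʳ-≤; +-cancelˡ-<; +-comm; suc-injective;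
        ⊔-identityʳ; +-0-commutativeMonoid; module ≤-Reasoning)
open import Algebra.Properties.CommutativeMonoid.Sum +-0-commutativeMonoid
  using (sum; sum-syntax; ∑-comm; ∑-distrib-+; sum-cong-≗)
open import Data.Nat.Tactic.RingSolver using (solve-∀)
open import Data.Product using (∃; _×_; _,_; proj₁; proj₂; uncurry; map₁; map₂)
import Data.Rational.Unnormalised as ℚᵘ
open ℚᵘ using (ℚᵘ; *≤*)
open import Data.Sum using (_⊎_; inj₁; inj₂)
import Data.Vec.Functional as Vector
open import Function using (_∘_; id; Inverse; Equivalence; mk⇔)
open import Relation.Binary.Definitions using (tri<; tri≈; tri>)
open import Relation.Binary.PropositionalEquality
open import Relation.Nullary using (¬_; Dec; yes; no; contradiction)
open import Relation.Nullary.Decidable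
  using (map′; _×-dec_; _→-dec_; _⊎-dec_; ¬?; ⌊_⌋; does; does-⇔; isYes≗does; toWitness;
        fromWitness; decidable-stable)
open import Defs

-- Decidability of saturation

-- Reduces a search to finitely many codes. The element decoded by `cover` need not be `a` itself:
-- functions come back only pointwise equal, and colourings only up to a renaming of colours.
∃-dec : {A : Set} {P : A → Set} {N : ℕ} (decode : Fin N → A) →
        (∀ {a} → P a → ∃ λ i → P (decode i)) →
        (∀ a → Dec (P a)) → Dec (∃ P)
∃-dec decode cover P? =
  map′ (λ (i , p) → decode i , p) (λ (a , p) → cover p) (any? (P? ∘ decode))

least : {P : ℕ → Set} → (∀ k → Dec (P k)) → ∀ N → P N →
        ∃ λ m → P m × m ≤ N × (∀ k → P k → m ≤ k)
least {P} P? = <-rec _ step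
  where
  step : ∀ N → (∀ {k} → k < N → P k → _) → P N → _
  step N rec pN with anyUpTo? P? N
  ... | yes (k , k<N , pk) =
        let m , pm , m≤k , min = rec k<N pk
        in m , pm , ≤-trans m≤k (<⇒≤ k<N) , min
  ... | no  none = N , pN , ≤-refl , λ k pk → ≮⇒≥ λ k<N → none (k , k<N , pk)

proper-anti : ∀ {n} {G G′ : Graph n} {c} → (∀ {x y} → Adj G x y → Adj G′ x y) →
              Proper G′ c → Proper G c
proper-anti G⊆G′ proper x y z xy xz = proper x y z (G⊆G′ xy) (G⊆G′ xz)

proper? : ∀ {n} (G : Graph n) (c : Colouring n) → Dec (Proper G c)
proper? G c = all? λ x → all? λ y → all? λ z →
  T? _ →-dec T? _ →-dec ¬? (y ≟ z) →-dec ¬? (colour c x y ℕ.≟ colour c x z)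

sameEdge? : ∀ {m} (a b a′ b′ : Fin m) → Dec (SameEdge a b a′ b′)
sameEdge? a b a′ b′ =
  ((a ≟ a′) ×-dec (b ≟ b′)) ⊎-dec ((a ≟ b′) ×-dec (b ≟ a′))

module _ {k n : ℕ} (H : Graph k) where

  Free : Graph n → Colouring n → Set
  Free G c = Proper G c × ¬ RainbowCopy H G c

  copy-mono : ∀ {G G′ : Graph n} {c} → (∀ {x y} → Adj G x y → Adj G′ x y) →
              RainbowCopy H G c → RainbowCopy H G′ c
  copy-mono G⊆G′ r = record
    { embed = embed ; injective = injective
    ; preserves = λ a b → G⊆G′ ∘ preserves a b ; rainbow = rainbow }
    where open RainbowCopy r

  copy? : (G : Graph n) (c : Colouring n) → Dec (RainbowCopy H G c)
  copy? G c = map′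
    (λ (φ , inj , pres , rain) → record
      { embed = φ ; injective = inj _ _ ; preserves = pres ; rainbow = rain })
    (λ r → let open RainbowCopy r in embed , (λ _ _ → injective) , preserves , rainbow)
    (∃-dec finToFun cover isCopy?)
    where
    IsCopy : (Fin k → Fin n) → Set
    IsCopy φ = (∀ a b → φ a ≡ φ b → a ≡ b)
             × (∀ a b → Adj H a b → Adj G (φ a) (φ b))
             × (∀ a b a′ b′ → Adj H a b → Adj H a′ b′ → ¬ SameEdge a b a′ b′ →
                colour c (φ a) (φ b) ≢ colour c (φ a′) (φ b′))

    isCopy? : ∀ φ → Dec (IsCopy φ)
    isCopy? φ =
      (all? λ a → all? λ b → (φ a ≟ φ b) →-dec (a ≟ b)) ×-dec
      (all? λ a → all? λ b → T? _ →-dec T? _) ×-dec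
      (all? λ a → all? λ b → all? λ a′ → all? λ b′ →
        T? _ →-dec T? _ →-dec ¬? (sameEdge? a b a′ b′) →-dec ¬? (_ ℕ.≟ _))

    cover : ∀ {φ} → IsCopy φ → ∃ λ i → IsCopy (finToFun i)
    cover {φ} (inj , pres , rain) = funToFin φ
      , (λ a b eq → inj a b (trans (sym (φ≗ a)) (trans eq (φ≗ b))))
      , (λ a b ab → subst₂ (Adj G) (sym (φ≗ a)) (sym (φ≗ b)) (pres a b ab))
      , (λ a b a′ b′ ab ab′ ≠ eq → rain a b a′ b′ ab ab′ ≠
           (trans (sym (cong₂ (colour c) (φ≗ a) (φ≗ b)))
             (trans eq (cong₂ (colour c) (φ≗ a′) (φ≗ b′)))))
      where
      φ≗ : ∀ a → finToFun (funToFin φ) a ≡ φ a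
      φ≗ = finToFun-funToFin φ

-- Only the partition into colour classes matters, so a colour can be replaced
-- by the index of a chosen pair that has it.
module _ {m} (f : Fin m → ℕ) where

  private
    -- The second argument is a fallback for a colour that does not occur. For a colour that occurs,
    -- the result depends on the colour alone, which makes representatives canonical.
    chosen : ∀ {v} → Dec (∃ λ i → f i ≡ v) → Fin m → Fin m
    chosen (yes (i , _)) _ = i
    chosen (no _)        i = i

    representativeOf : ℕ → Fin m → Fin m
    representativeOf v = chosen (any? (λ j → f j ℕ.≟ v))

    representativeOf-≡ : ∀ v {i} → f i ≡ v → f (representativeOf v i) ≡ v
    representativeOf-≡ v fi≡v with any? (λ j → f j ℕ.≟ v)
    ... | yes (_ , eq) = eq
    ... | no  _        = fi≡v

    representativeOf-irrelevant : ∀ v {i j} → f i ≡ v → representativeOf v i ≡ representativeOf v j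
    representativeOf-irrelevant v fi≡v with any? (λ j → f j ℕ.≟ v)
    ... | yes _    = refl
    ... | no  none = contradiction (_ , fi≡v) none

  representative : Fin m → Fin m
  representative i = representativeOf (f i) i

  representative-cong : ∀ {i j} → f i ≡ f j → representative i ≡ representative j
  representative-cong {i} {j} eq =
    trans (representativeOf-irrelevant (f i) refl) (cong (λ v → representativeOf v j) eq)

  representative-reflects : ∀ {i j} → representative i ≡ representative j → f i ≡ f j
  representative-reflects {i} {j} eq =
    trans (sym (representativeOf-≡ (f i) refl)) (trans (cong f eq) (representativeOf-≡ (f j) refl))

-- Finite codes for colourings and graphs

module _ {n : ℕ} where

  -- A code is a table of `n * n` entries below `n * n`, which suffices because chosen pairs serve
  -- as colours. The maximum with the transpose makes every table symmetric and leaves symmetric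
  -- tables unchanged.
  colouringOf : Fin ((n * n) ^ (n * n)) → Colouring n
  colouringOf t = record
    { colour     = λ x y → entry x y ⊔ entry y x
    ; colour-sym = λ x y → ⊔-comm (entry x y) (entry y x)
    }
    where
    entry : Fin n → Fin n → ℕ
    entry x y = toℕ (finToFun t (combine x y))

  -- Intersecting with the transpose and with the complete graph turns any bit table into a graph,
  -- and changes nothing in a table that comes from a graph.
  graphOf : Fin (2 ^ (n * n)) → Graph n
  graphOf t = record
    { adj        = λ x y → (entry x y ∧ entry y x) ∧ adj (K n) x y
    ; adj-sym    = λ x y → cong₂ _∧_ (∧-comm (entry x y) (entry y x)) (adj-sym (K n) x y)
    ; adj-irrefl = λ x → trans (cong ((entry x x ∧ entry x x) ∧_) (adj-irrefl (K n) x)) (∧-zeroʳ _)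
    }
    where
    entry : Fin n → Fin n → Bool
    entry x y = Inverse.to 2↔Bool (finToFun t (combine x y))

  -- Only equality of colours survives coding, but in both directions: properness is carried over by
  -- reflecting equalities, rainbow-freeness by preserving them.
  colouringOf-cover : (c : Colouring n) → ∃ λ t → ∀ x y z w →
    (colour c x y ≡ colour c z w → colour (colouringOf t) x y ≡ colour (colouringOf t) z w) ×
    (colour (colouringOf t) x y ≡ colour (colouringOf t) z w → colour c x y ≡ colour c z w)
  colouringOf-cover c = t , λ x y z w →
    (λ eq → trans (colour-t x y) (trans (cong toℕ
      (representative-cong flat (trans (flat-combine x y) (trans eq (sym (flat-combine z w))))))
      (sym (colour-t z w)))) ,
    (λ eq → trans (sym (flat-combine x y)) (trans (representative-reflects flat
      (toℕ-injective (trans (sym (colour-t x y)) (trans eq (colour-t z w))))) (flat-combine z w)))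
    where
    flat : Fin (n * n) → ℕ
    flat = uncurry (colour c) ∘ remQuot n

    t : Fin ((n * n) ^ (n * n))
    t = funToFin (representative flat)

    flat-combine : ∀ x y → flat (combine x y) ≡ colour c x y
    flat-combine x y = cong (uncurry (colour c)) (remQuot-combine x y)

    entry-t : ∀ x y → toℕ (finToFun t (combine x y)) ≡ toℕ (representative flat (combine x y))
    entry-t x y = cong toℕ (finToFun-funToFin (representative flat) (combine x y))

    colour-t : ∀ x y → colour (colouringOf t) x y ≡ toℕ (representative flat (combine x y))
    colour-t x y = trans (cong₂ _⊔_ (entry-t x y) (trans (entry-t y x) (cong toℕ
      (representative-cong flat (trans (flat-combine y x)
        (trans (colour-sym c y x) (sym (flat-combine x y)))))))) (⊔-idem _)

  graphOf-cover : (G : Graph n) → ∃ λ t → ∀ x y → adj (graphOf t) x y ≡ adj G x y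
  graphOf-cover G = t , λ x y →
    trans (cong (_∧ adj (K n) x y) (trans (cong₂ _∧_ (entry-t x y)
      (trans (entry-t y x) (adj-sym G y x))) (∧-idem _))) (absorb x y)
    where
    flat : Fin (n * n) → Fin 2
    flat = Inverse.from 2↔Bool ∘ uncurry (adj G) ∘ remQuot n

    t : Fin (2 ^ (n * n))
    t = funToFin flat

    entry-t : ∀ x y → Inverse.to 2↔Bool (finToFun t (combine x y)) ≡ adj G x y
    entry-t x y = trans (cong (Inverse.to 2↔Bool) (finToFun-funToFin flat (combine x y)))
      (trans (Inverse.strictlyInverseˡ 2↔Bool _) (cong (uncurry (adj G)) (remQuot-combine x y)))

    absorb : ∀ x y → adj G x y ∧ not ⌊ x ≟ y ⌋ ≡ adj G x y
    absorb x y with x ≟ y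
    ... | yes refl = trans (∧-zeroʳ _) (sym (adj-irrefl G x))
    ... | no  _    = ∧-identityʳ _

module _ {k n : ℕ} (H : Graph k) where

  free? : (G : Graph n) → Dec (∃ (Free H G))
  free? G = ∃-dec colouringOf
    (λ {c} (proper , free) → let t , classes = colouringOf-cover c in
      t
      , (λ x y z xy xz y≢z → proper x y z xy xz y≢z ∘ proj₂ (classes x y x z))
      , λ r → let open RainbowCopy r in free (record
          { embed = embed ; injective = injective ; preserves = preserves
          ; rainbow = λ a b a′ b′ ab ab′ ≠ → rainbow a b a′ b′ ab ab′ ≠ ∘ proj₁ (classes _ _ _ _) }))
    (λ c → proper? G c ×-dec ¬? (copy? H G c))

  -- A negated existence instead of a statement about all colourings, so that `free?` decides it.
  -- Decidability of rainbow copies recovers the positive form.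
  Maximal : Graph n → Set
  Maximal G = ∀ u v (u≢v : u ≢ v) → ¬ Adj G u v → ¬ ∃ (Free H (addEdge G u v u≢v))

  maximal? : (G : Graph n) → Dec (Maximal G)
  maximal? G = all? λ u → all? λ v → forced? u v
    where
    forced? : ∀ u v → Dec (∀ (u≢v : u ≢ v) → ¬ Adj G u v → ¬ ∃ (Free H (addEdge G u v u≢v)))
    forced? u v with u ≟ v
    ... | yes u≡v = yes λ u≢v → contradiction u≡v u≢v
    -- ⊥ is proof-irrelevant, so f does not depend on the proof of u ≢ v.
    ... | no  u≢v = map′ (λ f _ → f) (λ f → f u≢v)
                      (¬? (T? _) →-dec ¬? (free? (addEdge G u v u≢v)))

  toSaturated : ∀ {G : Graph n} → ∃ (Free H G) → Maximal G → ProperlyRainbowSaturated H G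
  toSaturated free maximal = record
    { rainbow-free = free
    ; maximal = λ u v u≢v uv c proper → decidable-stable (copy? H _ c)
        λ none → maximal u v u≢v uv (c , proper , none) }

  fromSaturated : ∀ {G : Graph n} → ProperlyRainbowSaturated H G → ∃ (Free H G) × Maximal G
  fromSaturated sat = rainbow-free
    , λ u v u≢v uv (c , proper , none) → none (maximal u v u≢v uv c proper)
    where open ProperlyRainbowSaturated sat

  saturated? : (G : Graph n) → Dec (ProperlyRainbowSaturated H G)
  saturated? G = map′ (λ (f , m) → toSaturated f m) fromSaturated (free? G ×-dec maximal? G)

  free-resp : ∀ {G G′ : Graph n} → (∀ x y → adj G x y ≡ adj G′ x y) →
              ∃ (Free H G) → ∃ (Free H G′)
  free-resp {G} {G′} eq (c , proper , none) =
    c , proper-anti {n} {G′} {G} {c} (λ {x} {y} → subst T (sym (eq x y))) proper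
      , none ∘ copy-mono H {G′} {G} {c} (λ {x} {y} → subst T (sym (eq x y)))

  saturated-resp : ∀ {G G′ : Graph n} → (∀ x y → adj G x y ≡ adj G′ x y) →
                   ProperlyRainbowSaturated H G → ProperlyRainbowSaturated H G′
  saturated-resp {G} {G′} eq sat =
    let free , maximal = fromSaturated sat in
    toSaturated (free-resp eq free) λ u v u≢v uv →
      maximal u v u≢v (uv ∘ subst T (eq u v)) ∘
      free-resp {addEdge G′ u v u≢v} {addEdge G u v u≢v} λ x y → cong (_∨ _) (sym (eq x y))

  numEdges-resp : ∀ {G G′ : Graph n} → (∀ x y → adj G x y ≡ adj G′ x y) →
                  numEdges G ≡ numEdges G′
  numEdges-resp eq = cong length (filter-≐ _ _
    ( (λ {(x , y)} → map₂ (subst T (eq x y)))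
    , (λ {(x , y)} → map₂ (subst T (sym (eq x y))))) (cartesianProduct (allFin n) (allFin n)))

  -- Saturation and the number of edges depend only on the values of `adj`, so testing all decoded
  -- graphs decides which edge numbers are attained. The given graph bounds the search for the least
  -- one.
  sat*-exists : (G : Graph n) → ProperlyRainbowSaturated H G →
                ∃ λ m → IsSat* n H m × m ≤ numEdges G
  sat*-exists G sat =
    let m , attained , m≤ , minimal = least attained? (numEdges G) (G , sat , refl)
    in m , record { attained = attained
                  ; minimal  = λ G′ sat′ → minimal _ (G′ , sat′ , refl) } , m≤
    where
    attained? : ∀ m → Dec (∃ λ (G : Graph n) → ProperlyRainbowSaturated H G × numEdges G ≡ m)
    attained? m = ∃-dec graphOf
      (λ {G} (sat , edges≡m) → let t , eq = graphOf-cover G in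
        t , saturated-resp (λ x y → sym (eq x y)) sat ,
          trans (numEdges-resp {graphOf t} {G} eq) edges≡m)
      (λ G → saturated? G ×-dec (numEdges G ℕ.≟ m))

-- Proper colourings of K₆ without a rainbow K₄

indicator : {P : Set} → Dec P → ℕ
indicator P? = if does P? then 1 else 0

1≤indicator : ∀ {P : Set} (P? : Dec P) → P → 1 ≤ indicator P?
1≤indicator (yes _) _ = ≤-refl
1≤indicator (no ¬p) p = contradiction p ¬p

indicator-≤ : ∀ {P : Set} {m} (P? : Dec P) → (P → 1 ≤ m) → indicator P? ≤ m
indicator-≤ (yes p) 1≤m = 1≤m p
indicator-≤ (no  _) _   = z≤n

sum-mono-≤ : ∀ {n} {f g : Fin n → ℕ} → (∀ i → f i ≤ g i) → sum f ≤ sum g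
sum-mono-≤ {ℕ.zero}  f≤g = z≤n
sum-mono-≤ {ℕ.suc n} f≤g = +-mono-≤ (f≤g zero) (sum-mono-≤ (f≤g ∘ suc))

sum-mono-< : ∀ {n} {f g : Fin n → ℕ} → (∀ i → f i ≤ g i) → ∀ i → f i < g i → sum f < sum g
sum-mono-< f≤g zero    f<g = +-mono-<-≤ f<g (sum-mono-≤ (f≤g ∘ suc))
sum-mono-< f≤g (suc i) f<g = +-mono-≤-< (f≤g zero) (sum-mono-< (f≤g ∘ suc) i f<g)

sum-indicator-≤ : ∀ {n} {P : Fin n → Set} {Q : Set} (P? : ∀ i → Dec (P i)) (Q? : Dec Q) →
                  (∀ i j → P i → P j → i ≡ j) → (∀ i → P i → Q) →
                  sum (indicator ∘ P?) ≤ indicator Q?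
sum-indicator-≤ {ℕ.zero}  P? Q? unique P⇒Q = z≤n
sum-indicator-≤ {ℕ.suc n} P? Q? unique P⇒Q with P? zero
... | no _ = sum-indicator-≤ (P? ∘ suc) Q?
               (λ i j p q → Finₚ.suc-injective (unique (suc i) (suc j) p q)) (P⇒Q ∘ suc)
... | yes p with Q?
...   | no ¬q = contradiction (P⇒Q zero p) ¬q
-- `no id` decides the empty proposition and gives the bound 0: after a success at the head,
-- uniqueness rules out every index of the tail.
...   | yes _ = s≤s (sum-indicator-≤ (P? ∘ suc) (no id)
                  (λ i j p′ _ → contradiction (unique zero (suc i) p p′) λ ())
                  (λ i p′ → contradiction (unique zero (suc i) p p′) λ ()))

Distinct₃ : ∀ {n} → Fin n → Fin n → Fin n → Set
Distinct₃ x y z = x ≢ y × x ≢ z × y ≢ z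

distinct₃? : ∀ {n} (x y z : Fin n) → Dec (Distinct₃ x y z)
distinct₃? x y z = ¬? (x ≟ y) ×-dec ¬? (x ≟ z) ×-dec ¬? (y ≟ z)

Distinct₄ : ∀ {n} → Fin n → Fin n → Fin n → Fin n → Set
Distinct₄ x y z w = Distinct₃ x y z × x ≢ w × y ≢ w × z ≢ w

distinct₄? : ∀ {n} (x y z w : Fin n) → Dec (Distinct₄ x y z w)
distinct₄? x y z w = distinct₃? x y z ×-dec ¬? (x ≟ w) ×-dec ¬? (y ≟ w) ×-dec ¬? (z ≟ w)

∑₃ : ∀ {n} → (Fin n → Fin n → Fin n → ℕ) → ℕ
∑₃ {n} f = ∑[ x < n ] ∑[ y < n ] ∑[ z < n ] f x y z

∑₄ : ∀ {n} → (Fin n → Fin n → Fin n → Fin n → ℕ) → ℕ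
∑₄ {n} f = ∑₃ λ x y z → ∑[ w < n ] f x y z w

module _ {n : ℕ} where

  ∑₄-mono-≤ : ∀ {f g : Fin n → Fin n → Fin n → Fin n → ℕ} →
              (∀ x y z w → f x y z w ≤ g x y z w) → ∑₄ f ≤ ∑₄ g
  ∑₄-mono-≤ f≤g = sum-mono-≤ λ x → sum-mono-≤ λ y → sum-mono-≤ λ z → sum-mono-≤ (f≤g x y z)

  ∑₄-distrib-+ : ∀ (f g : Fin n → Fin n → Fin n → Fin n → ℕ) →
                 ∑₄ (λ x y z w → f x y z w + g x y z w) ≡ ∑₄ f + ∑₄ g
  ∑₄-distrib-+ f g =
    sum-+ (λ x → ∑₃ (f x)) (λ x → ∑₃ (g x)) λ x →
      sum-+ (λ y → ∑[ z < n ] sum (f x y z)) (λ y → ∑[ z < n ] sum (g x y z)) λ y →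
        sum-+ (λ z → sum (f x y z)) (λ z → sum (g x y z)) λ z →
          ∑-distrib-+ (f x y z) (g x y z)
    where
    sum-+ : ∀ (f g : Fin n → ℕ) {h} → (∀ i → h i ≡ f i + g i) → sum h ≡ sum f + sum g
    sum-+ f g h≡f+g = trans (sum-cong-≗ h≡f+g) (∑-distrib-+ f g)

  ∑₄-swap₂₃ : ∀ (f : Fin n → Fin n → Fin n → Fin n → ℕ) → ∑₄ (λ x y z w → f x z y w) ≡ ∑₄ f
  ∑₄-swap₂₃ f = sum-cong-≗ λ x → ∑-comm λ y z → ∑[ w < n ] f x z y w

  ∑₄-swap₃₄ : ∀ (f : Fin n → Fin n → Fin n → Fin n → ℕ) → ∑₄ (λ x y z w → f x y w z) ≡ ∑₄ f
  ∑₄-swap₃₄ f = sum-cong-≗ λ x → sum-cong-≗ λ y → ∑-comm λ z w → f x y w z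

triples : ℕ → ℕ
triples n = ∑₃ λ (x y z : Fin n) → indicator (distinct₃? x y z)

quadruples : ℕ → ℕ
quadruples n = ∑₄ λ (x y z w : Fin n) → indicator (distinct₄? x y z w)

-- Among (x , y , z , w), (x , z , y , w) and (x , w , y , z) one satisfies
-- c x y ≡ c z w, so at least a third of the quadruples do; as w is determined
-- by (x , y , z), at most as many do as there are triples.  For n ≡ 6 the two
-- bounds agree.
module _ {n} (c : Fin n → Fin n → ℕ)
         (proper : ∀ x y z → Distinct₃ x y z → c x y ≢ c x z)
         (opposite : ∀ x y z w → Distinct₄ x y z w →
                     c x y ≡ c z w ⊎ c x z ≡ c y w ⊎ c x w ≡ c y z)
         where

  private
    Parallel : Fin n → Fin n → Fin n → Fin n → Set
    Parallel x y z w = Distinct₄ x y z w × c x y ≡ c z w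

    parallel? : ∀ x y z w → Dec (Parallel x y z w)
    parallel? x y z w = distinct₄? x y z w ×-dec (c x y ℕ.≟ c z w)

    p : Fin n → Fin n → Fin n → Fin n → ℕ
    p x y z w = indicator (parallel? x y z w)

    d : Fin n → Fin n → Fin n → Fin n → ℕ
    d x y z w = indicator (distinct₄? x y z w)

    d≤p+p+p : ∀ x y z w → d x y z w ≤ p x y z w + (p x z y w + p x w y z)
    d≤p+p+p x y z w = indicator-≤ (distinct₄? x y z w) 1≤p+p+p
      where
      1≤p+p+p : Distinct₄ x y z w → 1 ≤ p x y z w + (p x z y w + p x w y z)
      1≤p+p+p δ@((xy , xz , yz) , xw , yw , zw) with opposite x y z w δ
      ... | inj₁ e        = ≤-trans (1≤indicator (parallel? x y z w) (δ , e)) (m≤m+n _ _)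
      ... | inj₂ (inj₁ e) = ≤-trans (1≤indicator (parallel? x z y w)
                              (((xz , xy , yz ∘ sym) , xw , zw , yw) , e))
                              (≤-trans (m≤m+n _ _) (m≤n+m _ (p x y z w)))
      ... | inj₂ (inj₂ e) = ≤-trans (1≤indicator (parallel? x w y z)
                              (((xw , xy , yw ∘ sym) , xz , zw ∘ sym , yz) , e))
                              (≤-trans (m≤n+m _ (p x z y w)) (m≤n+m _ (p x y z w)))

    quadruples≤3∑p : quadruples n ≤ ∑₄ p + (∑₄ p + ∑₄ p)
    quadruples≤3∑p = begin
      ∑₄ d                                                   ≤⟨ ∑₄-mono-≤ d≤p+p+p ⟩
      ∑₄ (λ x y z w → p x y z w + (p x z y w + p x w y z))
        ≡⟨ ∑₄-distrib-+ p (λ x y z w → p x z y w + p x w y z) ⟩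
      ∑₄ p + ∑₄ (λ x y z w → p x z y w + p x w y z)
        ≡⟨ cong (λ k → ∑₄ p + k) (∑₄-distrib-+ (λ x y z w → p x z y w) (λ x y z w → p x w y z)) ⟩
      ∑₄ p + (∑₄ (λ x y z w → p x z y w) + ∑₄ (λ x y z w → p x w y z))
        -- Both sums equal `∑₄ p` up to the order of summation; the second permutation is cyclic,
        -- hence two transpositions.
        ≡⟨ cong (λ k → ∑₄ p + k) (cong₂ _+_ (∑₄-swap₂₃ p)
             (trans (∑₄-swap₃₄ λ x y z w → p x z y w) (∑₄-swap₂₃ p))) ⟩
      ∑₄ p + (∑₄ p + ∑₄ p)                                   ∎
      where open ≤-Reasoning

    -- Properness at `z` leaves at most one `w`, so the sum is 0 or 1. An empty `Q` expresses that
    -- it is 0.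
    ∑p≤ : ∀ x y z {Q : Set} (Q? : Dec Q) → (∀ w → Parallel x y z w → Q) →
          ∑[ w < n ] p x y z w ≤ indicator Q?
    ∑p≤ x y z Q? = sum-indicator-≤ (parallel? x y z) Q? λ where
      w w′ ((_ , _ , _ , zw) , e) ((_ , _ , _ , zw′) , e′) →
        decidable-stable (w ≟ w′) λ w≢w′ → proper z w w′ (zw , zw′ , w≢w′) (trans (sym e) e′)

  every-colour-at-every-vertex : triples n + (triples n + triples n) ≤ quadruples n →
    ∀ x y z → Distinct₃ x y z → ∃ λ w → z ≢ w × c x y ≡ c z w
  every-colour-at-every-vertex 3t≤q x y z δ with any? (parallel? x y z)
  ... | yes (w , (_ , _ , _ , z≢w) , e) = w , z≢w , e
  -- A single triple without such a `w` makes `∑₄ p` strictly smaller than the number of triples, so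
  -- three times it falls short of the number of quadruples.
  ... | no none = contradiction (≤-trans 3t≤q quadruples≤3∑p)
      (<⇒≱ (+-mono-< ∑p<triples (+-mono-< ∑p<triples ∑p<triples)))
    where
    r : Fin n → Fin n → Fin n → ℕ
    r x y z = indicator (distinct₃? x y z)

    p≤r : ∀ x y z → ∑[ w < n ] p x y z w ≤ r x y z
    p≤r x y z = ∑p≤ x y z (distinct₃? x y z) λ _ → proj₁ ∘ proj₁

    p<r : ∑[ w < n ] p x y z w < r x y z
    p<r = ≤-trans (s≤s (∑p≤ x y z (no id) λ w e → none (w , e)))
                  (1≤indicator (distinct₃? x y z) δ)

    ∑p<triples : ∑₄ p < triples n
    ∑p<triples = sum-mono-< (λ x → sum-mono-≤ λ y → sum-mono-≤ (p≤r x y)) x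
                   (sum-mono-< (λ y → sum-mono-≤ (p≤r x y)) y
                     (sum-mono-< (p≤r x y) z p<r))

-- The three perfect matchings of K₄, each in both orders of its two edges; orientations are left to
-- `SameEdge`.
opposite-pairs : List ((Fin 4 × Fin 4) × (Fin 4 × Fin 4))
opposite-pairs =
  ((0F , 1F) , (2F , 3F)) ∷ ((0F , 2F) , (1F , 3F)) ∷ ((0F , 3F) , (1F , 2F)) ∷
  ((2F , 3F) , (0F , 1F)) ∷ ((1F , 3F) , (0F , 2F)) ∷ ((1F , 2F) , (0F , 3F)) ∷ []

abstract
  opposite-pairs-exhaustive : ∀ a b a′ b′ → Distinct₄ a b a′ b′ →
    Any (λ ((x , y) , (z , w)) → SameEdge a b x y × SameEdge a′ b′ z w) opposite-pairs
  opposite-pairs-exhaustive = toWitness {a? =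
    all? λ a → all? λ b → all? λ a′ → all? λ b′ → distinct₄? a b a′ b′ →-dec
      Any.any? (λ ((x , y) , (z , w)) → sameEdge? a b x y ×-dec sameEdge? a′ b′ z w)
        opposite-pairs} _

K-adj⇒≢ : ∀ {k} {a b : Fin k} → Adj (K k) a b → a ≢ b
K-adj⇒≢ {a = a} {b} ab with a ≟ b
... | no a≢b = a≢b

adj⇒≢ : ∀ {n} (G : Graph n) {x y} → Adj G x y → x ≢ y
adj⇒≢ G xy refl = subst T (adj-irrefl G _) xy

module _ {n} {G : Graph n} {c : Colouring n} (proper : Proper G c) where

  private
    flip : ∀ {x y} → Adj G x y → Adj G y x
    flip = subst T (adj-sym G _ _)

    swapped : ∀ {x y z w} → colour c x y ≡ colour c z w → colour c y x ≡ colour c z w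
    swapped = trans (colour-sym c _ _)

  -- Two edges of a K₄ are either incident, and then properness separates them, or opposite. Hence
  -- only the three opposite pairs have to be compared.
  rainbowK₄ : ∀ {x y z w} →
    Adj G x y → Adj G x z → Adj G x w → Adj G y z → Adj G y w → Adj G z w →
    colour c x y ≢ colour c z w → colour c x z ≢ colour c y w → colour c x w ≢ colour c y z →
    RainbowCopy (K 4) G c
  rainbowK₄ {x} {y} {z} {w} xy xz xw yz yw zw ≢₁ ≢₂ ≢₃ = record
    { embed     = φ
    ; injective = λ {a} {b} eq → decidable-stable (a ≟ b) λ a≢b → adj⇒≢ G (clique a b a≢b) eq
    ; preserves = λ a b ab → clique a b (K-adj⇒≢ ab)
    ; rainbow   = λ a b a′ b′ ab a′b′ → rainbow a b a′ b′ (K-adj⇒≢ ab) (K-adj⇒≢ a′b′)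
    }
    where
    φ : Fin 4 → Fin n
    φ = Vector.fromList (x ∷ y ∷ z ∷ w ∷ [])

    col : Fin 4 → Fin 4 → ℕ
    col a b = colour c (φ a) (φ b)

    clique : ∀ a b → a ≢ b → Adj G (φ a) (φ b)
    clique 0F 0F a≢b = contradiction refl a≢b
    clique 0F 1F _   = xy
    clique 0F 2F _   = xz
    clique 0F 3F _   = xw
    clique 1F 0F _   = flip xy
    clique 1F 1F a≢b = contradiction refl a≢b
    clique 1F 2F _   = yz
    clique 1F 3F _   = yw
    clique 2F 0F _   = flip xz
    clique 2F 1F _   = flip yz
    clique 2F 2F a≢b = contradiction refl a≢b
    clique 2F 3F _   = zw
    clique 3F 0F _   = flip xw
    clique 3F 1F _   = flip yw
    clique 3F 2F _   = flip zw
    clique 3F 3F a≢b = contradiction refl a≢b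

    col-sameEdge : ∀ {a b a′ b′} → SameEdge a b a′ b′ → col a b ≡ col a′ b′
    col-sameEdge (inj₁ (refl , refl)) = refl
    col-sameEdge (inj₂ (refl , refl)) = colour-sym c _ _

    opposite : ∀ a b a′ b′ → Distinct₄ a b a′ b′ → col a b ≢ col a′ b′
    opposite a b a′ b′ δ eq =
      -- The six inequalities follow the order of `opposite-pairs`; the last three are the first
      -- three reversed.
      let ≢ , same , same′ = All.lookupAny
            {P = λ ((x , y) , (z , w)) → col x y ≢ col z w}
            (≢₁ ∷ ≢₂ ∷ ≢₃ ∷ ≢₁ ∘ sym ∷ ≢₂ ∘ sym ∷ ≢₃ ∘ sym ∷ [])
            (opposite-pairs-exhaustive a b a′ b′ δ)
      in ≢ (trans (sym (col-sameEdge same)) (trans eq (col-sameEdge same′)))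

    incident : ∀ {a b b′} → a ≢ b → a ≢ b′ → b ≢ b′ → col a b ≢ col a b′
    incident a≢b a≢b′ b≢b′ = proper _ _ _ (clique _ _ a≢b) (clique _ _ a≢b′)
                               (adj⇒≢ G (clique _ _ b≢b′))

    rainbow : ∀ a b a′ b′ → a ≢ b → a′ ≢ b′ → ¬ SameEdge a b a′ b′ → col a b ≢ col a′ b′
    -- If an endpoint is shared, both edges are oriented away from it and properness applies;
    -- otherwise the four endpoints are distinct.
    rainbow a b a′ b′ a≢b a′≢b′ ¬same eq with a ≟ a′ | a ≟ b′ | b ≟ a′ | b ≟ b′
    ... | yes refl | _ | _ | _ = incident a≢b a′≢b′ (λ { refl → ¬same (inj₁ (refl , refl)) }) eq
    ... | no _ | yes refl | _ | _ =
      incident a≢b (a′≢b′ ∘ sym) (λ { refl → ¬same (inj₂ (refl , refl)) })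
        (trans eq (colour-sym c _ _))
    ... | no _ | no a≢b′ | yes refl | _ = incident (a≢b ∘ sym) a′≢b′ a≢b′ (swapped eq)
    ... | no a≢a′ | no _ | no _ | yes refl =
      incident (a≢b ∘ sym) (a′≢b′ ∘ sym) a≢a′ (trans (swapped eq) (colour-sym c _ _))
    ... | no a≢a′ | no a≢b′ | no b≢a′ | no b≢b′ =
      opposite a b a′ b′ ((a≢b , a≢a′ , b≢a′) , a≢b′ , b≢b′ , a′≢b′) eq

  -- If the K₆ itself has no rainbow K₄, then v sends to each of a, b, d a
  -- colour that no edge of the K₆ has.
  vertex-joined-to-K₆ : (κ : Fin 6 → Fin n) → (∀ i j → i ≢ j → Adj G (κ i) (κ j)) →
    ∀ v → (∀ i → v ≢ κ i) → ∀ a b d → Distinct₃ a b d →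
    Adj G v (κ a) → Adj G v (κ b) → Adj G v (κ d) → RainbowCopy (K 4) G c
  vertex-joined-to-K₆ κ clique v v∉κ a b d δ@(a≢b , a≢d , b≢d) va vb vd =
    decidable-stable (copy? (K 4) G c) λ none → none
      (rainbowK₄ va vb vd (clique a b a≢b) (clique a d a≢d) (clique b d b≢d)
        (fresh none b d a (b≢d , a≢b ∘ sym , a≢d ∘ sym) va)
        (fresh none a d b (a≢d , a≢b , b≢d ∘ sym) vb)
        (fresh none a b d (a≢b , a≢d , b≢d) vd))
    where
    col : Fin 6 → Fin 6 → ℕ
    col i j = colour c (κ i) (κ j)

    opposite : ¬ RainbowCopy (K 4) G c → ∀ x y z w → Distinct₄ x y z w →
               col x y ≡ col z w ⊎ col x z ≡ col y w ⊎ col x w ≡ col y z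
    opposite none x y z w ((xy , xz , yz) , xw , yw , zw) = decidable-stable
      ((col x y ℕ.≟ col z w) ⊎-dec (col x z ℕ.≟ col y w) ⊎-dec (col x w ℕ.≟ col y z))
      λ ≢ → none (rainbowK₄ (clique x y xy) (clique x z xz) (clique x w xw)
                            (clique y z yz) (clique y w yw) (clique z w zw)
                            (≢ ∘ inj₁) (≢ ∘ inj₂ ∘ inj₁) (≢ ∘ inj₂ ∘ inj₂))

    fresh : ¬ RainbowCopy (K 4) G c → ∀ x y z → Distinct₃ x y z → Adj G v (κ z) →
            colour c v (κ z) ≢ col x y
    fresh none x y z δ vz eq =
      -- The colour of `x y` already occurs on an edge of the K₆ at `κ z`. That edge is incident
      -- with the one from `v`, and differs from it because `v` lies outside the K₆.
      let w , z≢w , xy≡zw = every-colour-at-every-vertex col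
            (λ x y z (xy , xz , yz) → proper _ _ _ (clique x y xy) (clique x z xz)
                                        (adj⇒≢ G (clique y z yz)))
            (opposite none)
            (≤-refl {360})  -- 3 · (6 · 5 · 4) = 6 · 5 · 4 · 3
            x y z δ
      in proper (κ z) v (κ w) (flip vz) (clique z w z≢w) (v∉κ w) (trans (swapped eq) xy≡zw)

-- K₆'s sharing an edge

K-≢⇒adj : ∀ {k} {a b : Fin k} → a ≢ b → Adj (K k) a b
K-≢⇒adj {a = a} {b} a≢b with a ≟ b
... | yes a≡b = contradiction a≡b a≢b
... | no  _   = _

addEdge-⊇ : ∀ {n} (G : Graph n) {u v} (u≢v : u ≢ v) {x y} →
            Adj G x y → Adj (addEdge G u v u≢v) x y
addEdge-⊇ G u≢v = Equivalence.from T-∨ ∘ inj₁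

addEdge-new : ∀ {n} (G : Graph n) {u v} (u≢v : u ≢ v) → Adj (addEdge G u v u≢v) u v
addEdge-new G {u} {v} u≢v = Equivalence.from (T-∨ {adj G u v}) (inj₂
  (Equivalence.from (T-∨ {⌊ u ≟ u ⌋ ∧ ⌊ v ≟ v ⌋}) (inj₁
    (Equivalence.from (T-∧ {⌊ u ≟ u ⌋}) (fromWitness refl , fromWitness refl)))))

nonzero : ∀ {m} → m ≢ 0 → ∃ λ k → m ≡ ℕ.suc k
nonzero {ℕ.zero}  m≢0 = contradiction refl m≢0
nonzero {ℕ.suc k} _   = k , refl

-- Division by 4 with remainder, written as a recursion so that it computes on `join₄ (suc q) r`.
split₄ : ℕ → ℕ × Fin 4
split₄ 0 = 0 , 0F
split₄ 1 = 0 , 1F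
split₄ 2 = 0 , 2F
split₄ 3 = 0 , 3F
split₄ (ℕ.suc (ℕ.suc (ℕ.suc (ℕ.suc m)))) = map₁ ℕ.suc (split₄ m)

join₄ : ℕ → Fin 4 → ℕ
join₄ q r = q * 4 + toℕ r

split₄-join₄ : ∀ q r → split₄ (join₄ q r) ≡ (q , r)
split₄-join₄ 0 0F = refl
split₄-join₄ 0 1F = refl
split₄-join₄ 0 2F = refl
split₄-join₄ 0 3F = refl
split₄-join₄ (ℕ.suc q) r = cong (map₁ ℕ.suc) (split₄-join₄ q r)

join₄-surjective : ∀ m → ∃ λ q → ∃ λ r → join₄ q r ≡ m
join₄-surjective 0 = 0 , 0F , refl
join₄-surjective 1 = 0 , 1F , refl
join₄-surjective 2 = 0 , 2F , refl
join₄-surjective 3 = 0 , 3F , refl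
join₄-surjective (ℕ.suc (ℕ.suc (ℕ.suc (ℕ.suc m)))) =
  let q , r , eq = join₄-surjective m in ℕ.suc q , r , cong (λ k → 4 + k) eq

join₄-injective : ∀ {q q′ r r′} → join₄ q r ≡ join₄ q′ r′ → (q , r) ≡ (q′ , r′)
join₄-injective {q} {q′} {r} {r′} eq =
  trans (sym (split₄-join₄ q r)) (trans (cong split₄ eq) (split₄-join₄ q′ r′))

-- Vertices 0 and 1 are the hubs, with block number 0; the remaining vertices
-- are cut into blocks of four, numbered from 1.  A block and the two hubs
-- span a K₆, in which a vertex is identified by its position.
label : ℕ → ℕ × Fin 6
label 0                 = 0 , 0F
label 1                 = 0 , 1F
label (ℕ.suc (ℕ.suc m)) = let q , r = split₄ m in ℕ.suc q , suc (suc r)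

block : ∀ {n} → Fin n → ℕ
block x = proj₁ (label (toℕ x))

position : ∀ {n} → Fin n → Fin 6
position x = proj₂ (label (toℕ x))

-- The inverse of `label` on the K₆ of block `suc q`: the index `q` is one less than the block
-- number, since 0 is reserved for the hubs.
vertex : ℕ → Fin 6 → ℕ
vertex q 0F            = 0
vertex q 1F            = 1
vertex q (suc (suc r)) = 2 + join₄ q r

blockAt : ℕ → Fin 6 → ℕ
blockAt q 0F            = 0
blockAt q 1F            = 0
blockAt q (suc (suc _)) = ℕ.suc q

label-vertex : ∀ q i → label (vertex q i) ≡ (blockAt q i , i)
label-vertex q 0F            = refl
label-vertex q 1F            = refl
label-vertex q (suc (suc r)) =
  cong (λ (q , r) → ℕ.suc q , suc (suc r)) (split₄-join₄ q r)

-- The graph of `label` as a relation, so that a case split into hubs and leaves replaces arithmetic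
-- with `split₄`.
data Label : ℕ → ℕ → Fin 6 → Set where
  hub₀ : Label 0 0 0F
  hub₁ : Label 1 0 1F
  leaf : ∀ q r → Label (2 + join₄ q r) (ℕ.suc q) (suc (suc r))

relabel : ∀ {x b b′ p p′} → Label x b p → b ≡ b′ → p ≡ p′ → Label x b′ p′
relabel l refl refl = l

labelled-ℕ : ∀ x → Label x (proj₁ (label x)) (proj₂ (label x))
labelled-ℕ 0 = hub₀
labelled-ℕ 1 = hub₁
labelled-ℕ (ℕ.suc (ℕ.suc m)) with join₄-surjective m
... | q , r , refl rewrite split₄-join₄ q r = leaf q r

labelled : ∀ {n} (x : Fin n) → Label (toℕ x) (block x) (position x)
labelled x = labelled-ℕ (toℕ x)

Linked : ℕ → ℕ → Set
Linked b b′ = b ≡ 0 ⊎ b′ ≡ 0 ⊎ b ≡ b′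

linked-sym : ∀ {b b′} → Linked b b′ → Linked b′ b
linked-sym (inj₁ e)        = inj₂ (inj₁ e)
linked-sym (inj₂ (inj₁ e)) = inj₁ e
linked-sym (inj₂ (inj₂ e)) = inj₂ (inj₂ (sym e))

linked? : ∀ b b′ → Dec (Linked b b′)
linked? b b′ = (b ℕ.≟ 0) ⊎-dec (b′ ℕ.≟ 0) ⊎-dec (b ℕ.≟ b′)

-- A position belongs to one hub, or to one leaf in each block; leaves have nonzero block numbers,
-- so linked leaves share their block.
label-injective : ∀ {x y b b′ p} → Label x b p → Label y b′ p → Linked b b′ → x ≡ y
label-injective hub₀       hub₀        _                  = refl
label-injective hub₁       hub₁        _                  = refl
label-injective (leaf q r) (leaf q′ .r) (inj₂ (inj₂ refl)) = refl

blockAt-linked : ∀ q i j → Linked (blockAt q i) (blockAt q j)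
blockAt-linked q 0F            _             = inj₁ refl
blockAt-linked q 1F            _             = inj₁ refl
blockAt-linked q (suc (suc _)) 0F            = inj₂ (inj₁ refl)
blockAt-linked q (suc (suc _)) 1F            = inj₂ (inj₁ refl)
blockAt-linked q (suc (suc _)) (suc (suc _)) = inj₂ (inj₂ refl)

vertex-position : ∀ {x q p} → Label x (ℕ.suc q) p → x ≡ vertex q p
vertex-position (leaf q r) = refl

position-leaf : ∀ {x b p} → Label x b p → 0 < b → 2 ≤ toℕ p
position-leaf (leaf q r) _ = s≤s (s≤s z≤n)

-- A block followed by a later one is complete: with `y` below `n`, all six vertices of its K₆ are
-- below `n` and differ from `y`.
vertex-< : ∀ q i {y b p} → Label y b p → ℕ.suc q < b → vertex q i < y
vertex-< q 0F            (leaf q′ r′) _         = z<s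
vertex-< q 1F            (leaf q′ r′) _         = s≤s z<s
vertex-< q (suc (suc r)) (leaf q′ r′) (s≤s q<q′) = +-monoʳ-< 2 (begin-strict
  q * 4 + toℕ r   <⟨ +-monoʳ-< (q * 4) (toℕ<n r) ⟩
  q * 4 + 4       ≡⟨ +-comm (q * 4) 4 ⟩
  ℕ.suc q * 4     ≤⟨ *-monoˡ-≤ 4 q<q′ ⟩
  q′ * 4          ≤⟨ m≤m+n (q′ * 4) (toℕ r′) ⟩
  join₄ q′ r′     ∎)
  where open ≤-Reasoning

module _ (n : ℕ) where

  -- By `label-injective`, linked vertices are distinct exactly when their positions are; positions
  -- are what `factor` colours.
  Joined : Fin n → Fin n → Set
  Joined x y = position x ≢ position y × Linked (block x) (block y)

  joined? : ∀ x y → Dec (Joined x y)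
  joined? x y = ¬? (position x ≟ position y) ×-dec linked? (block x) (block y)

  joined-sym : ∀ x y → Joined x y → Joined y x
  joined-sym x y (p≢ , link) = p≢ ∘ sym , linked-sym link

  sharedEdgeK₆s : Graph n
  sharedEdgeK₆s = record
    { adj        = λ x y → ⌊ joined? x y ⌋
    ; adj-sym    = λ x y → trans (isYes≗does (joined? x y))
        (trans (does-⇔ (mk⇔ (joined-sym x y) (joined-sym y x)) (joined? x y) (joined? y x))
               (sym (isYes≗does (joined? y x))))
    ; adj-irrefl = irrefl
    }
    where
    irrefl : ∀ x → ⌊ joined? x x ⌋ ≡ false
    irrefl x with joined? x x
    ... | yes (p≢ , _) = contradiction refl p≢
    ... | no  _        = refl

-- The 1-factorisation of K₆ on ℤ/5 and ∞ (position 0F), where i j has colour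
-- i + j and ∞ i has colour i + i.  The edge between the hubs has colour 0.
factor : Fin 6 → Fin 6 → Fin 5
factor zero    zero    = zero
factor zero    (suc j) = (toℕ j + toℕ j) mod 5
factor (suc i) zero    = (toℕ i + toℕ i) mod 5
factor (suc i) (suc j) = (toℕ i + toℕ j) mod 5

factor-sym : ∀ i j → factor i j ≡ factor j i
factor-sym zero    zero    = refl
factor-sym zero    (suc j) = refl
factor-sym (suc i) zero    = refl
factor-sym (suc i) (suc j) = cong (_mod 5) (+-comm (toℕ i) (toℕ j))

abstract
  factor-proper : ∀ p a b → p ≢ a → p ≢ b → factor p a ≡ factor p b → a ≡ b
  factor-proper = toWitness {a? = all? λ p → all? λ a → all? λ b →
    ¬? (p ≟ a) →-dec ¬? (p ≟ b) →-dec (factor p a ≟ factor p b) →-dec (a ≟ b)} _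

  -- Five colours on the six edges of a K₄ force a repetition, and properness makes the two edges
  -- disjoint. The proof evaluates all cases.
  factor-opposite : ∀ a b d e → Distinct₄ a b d e →
    factor a b ≡ factor d e ⊎ factor a d ≡ factor b e ⊎ factor a e ≡ factor b d
  factor-opposite = toWitness {a? = all? λ a → all? λ b → all? λ d → all? λ e →
    distinct₄? a b d e →-dec ((factor a b ≟ factor d e) ⊎-dec
      (factor a d ≟ factor b e) ⊎-dec (factor a e ≟ factor b d))} _

factor-hubs : ∀ {x y p p′} → Label x 0 p → Label y 0 p′ → p ≢ p′ → factor p p′ ≡ 0F
factor-hubs hub₀ hub₀ p≢ = contradiction refl p≢
factor-hubs hub₀ hub₁ _  = refl
factor-hubs hub₁ hub₀ _  = refl
factor-hubs hub₁ hub₁ p≢ = contradiction refl p≢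

-- The hub edge has colour 0, so properness of `factor` keeps 0 off every other edge at a hub.
factor≡0⇒hub : ∀ {x y b p p′} → Label x 0 p → Label y b p′ → p ≢ p′ → factor p p′ ≡ 0F → b ≡ 0
factor≡0⇒hub _    hub₀        _ _ = refl
factor≡0⇒hub _    hub₁        _ _ = refl
factor≡0⇒hub hub₀ (leaf q r) p≢ e =
  contradiction (factor-proper 0F 1F _ (λ ()) p≢ (sym e)) λ ()
factor≡0⇒hub hub₁ (leaf q r) p≢ e =
  contradiction (factor-proper 1F 0F _ (λ ()) p≢ (sym e)) λ ()

-- The factor containing the hub edge gets colour 0 in every block; the other four factors get
-- colours private to the block.
colourIn : ℕ → Fin 5 → ℕ
colourIn b zero    = 0
colourIn b (suc i) = ℕ.suc (join₄ b i)

colourIn-injective : ∀ {b b′ i i′} → colourIn b i ≡ colourIn b′ i′ → i ≡ i′ × (i ≡ 0F ⊎ b ≡ b′)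
colourIn-injective {i = zero}  {zero}   _  = refl , inj₁ refl
colourIn-injective {b} {b′} {suc i} {suc i′} eq
  with refl ← join₄-injective {b} {b′} {i} {i′} (suc-injective eq) =
  refl , inj₂ refl

-- A colouring without rainbow K₄, and saturation

module _ (n : ℕ) where

  private
    G : Graph n
    G = sharedEdgeK₆s n

    adj⇒joined : ∀ x y → Adj G x y → Joined n x y
    adj⇒joined x y = toWitness

    joined⇒adj : ∀ x y → Joined n x y → Adj G x y
    joined⇒adj x y = fromWitness

  -- On an edge with a leaf, the maximum is the block number of the K₆ containing it, because hubs
  -- have block number 0.
  blockwiseColouring : Colouring n
  blockwiseColouring = record
    { colour     = λ x y → colourIn (block x ⊔ block y) (factor (position x) (position y))
    ; colour-sym = λ x y → cong₂ colourIn (⊔-comm (block x) (block y))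
                                          (factor-sym (position x) (position y))
    }

  -- Equal colours at `x` give equal factors, hence equal positions of `y` and `z`, so it remains to
  -- link their blocks. If `x` is a hub, either the colour is 0 and `y` is the other hub, or the
  -- colour determines the block.
  blockwiseColouring-proper : Proper G blockwiseColouring
  blockwiseColouring-proper x y z xy xz y≢z eq =
    let p≢y , linkʸ = adj⇒joined x y xy
        p≢z , linkᶻ = adj⇒joined x z xz
        fy≡fz , 0⊎≡ = colourIn-injective eq
    in y≢z (toℕ-injective (label-injective (labelled y)
         (relabel (labelled z) refl (sym (factor-proper _ _ _ p≢y p≢z fy≡fz)))
         (linked p≢y linkʸ linkᶻ 0⊎≡)))
    where
    linked : position x ≢ position y → Linked (block x) (block y) → Linked (block x) (block z) →
             factor (position x) (position y) ≡ 0F ⊎ block x ⊔ block y ≡ block x ⊔ block z →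
             Linked (block y) (block z)
    linked _ (inj₂ (inj₁ y≡0)) _ _ = inj₁ y≡0
    linked _ _ (inj₂ (inj₁ z≡0)) _ = inj₂ (inj₁ z≡0)
    linked _ (inj₂ (inj₂ x≡y)) (inj₂ (inj₂ x≡z)) _ = inj₂ (inj₂ (trans (sym x≡y) x≡z))
    linked p≢ (inj₁ x≡0) _ (inj₁ f≡0) =
      inj₁ (factor≡0⇒hub (relabel (labelled x) x≡0 refl) (labelled y) p≢ f≡0)
    linked p≢ _ (inj₁ x≡0) (inj₁ f≡0) =
      inj₁ (factor≡0⇒hub (relabel (labelled x) x≡0 refl) (labelled y) p≢ f≡0)
    linked _ (inj₁ x≡0) _ (inj₂ e) =
      inj₂ (inj₂ (subst (λ b → b ⊔ block y ≡ b ⊔ block z) x≡0 e))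
    linked _ _ (inj₁ x≡0) (inj₂ e) =
      inj₂ (inj₂ (subst (λ b → b ⊔ block y ≡ b ⊔ block z) x≡0 e))

  -- Every clique lies in the K₆ of one block, where the colours are those of `factor` renamed, and
  -- `factor-opposite` yields a repetition.
  blockwiseColouring-free : ¬ RainbowCopy (K 4) G blockwiseColouring
  blockwiseColouring-free copy = clash
    (factor-opposite (p 0F) (p 1F) (p 2F) (p 3F)
      ((p≢ 0F 1F (λ ()) , p≢ 0F 2F (λ ()) , p≢ 1F 2F (λ ())) ,
       p≢ 0F 3F (λ ()) , p≢ 1F 3F (λ ()) , p≢ 2F 3F (λ ())))
    where
    open RainbowCopy copy

    b : Fin 4 → ℕ
    b = block ∘ embed

    p : Fin 4 → Fin 6
    p = position ∘ embed

    joined : ∀ i j → i ≢ j → Joined n (embed i) (embed j)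
    joined i j i≢j = adj⇒joined (embed i) (embed j) (preserves i j (K-≢⇒adj i≢j))

    p≢ : ∀ i j → i ≢ j → p i ≢ p j
    p≢ i j i≢j = proj₁ (joined i j i≢j)

    in-one-block : ∃ λ q → ∀ i → b i ≡ 0 ⊎ b i ≡ q
    in-one-block with any? (λ i → ¬? (b i ℕ.≟ 0))
    ... | no none = 0 , λ i → inj₁ (decidable-stable (b i ℕ.≟ 0) λ ≢0 → none (i , ≢0))
    ... | yes (i , bi≢0) = b i , same
      where
      same : ∀ j → b j ≡ 0 ⊎ b j ≡ b i
      same j with i ≟ j
      ... | yes refl = inj₂ refl
      ... | no  i≢j with proj₂ (joined i j i≢j)
      ...   | inj₁ bi≡0         = contradiction bi≡0 bi≢0
      ...   | inj₂ (inj₁ bj≡0)  = inj₁ bj≡0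
      ...   | inj₂ (inj₂ bi≡bj) = inj₂ (sym bi≡bj)

    colourIn-block : ∀ {q} → (∀ i → b i ≡ 0 ⊎ b i ≡ q) → ∀ i j → i ≢ j →
      colour blockwiseColouring (embed i) (embed j) ≡ colourIn q (factor (p i) (p j))
    colourIn-block {q} 0⊎q i j i≢j with 0⊎q i | 0⊎q j
    ... | inj₂ i≡q | inj₂ j≡q =
      cong (λ b → colourIn b (factor (p i) (p j))) (trans (cong₂ _⊔_ i≡q j≡q) (⊔-idem q))
    ... | inj₁ i≡0 | inj₂ j≡q =
      cong (λ b → colourIn b (factor (p i) (p j))) (cong₂ _⊔_ i≡0 j≡q)
    ... | inj₂ i≡q | inj₁ j≡0 =
      cong (λ b → colourIn b (factor (p i) (p j))) (trans (cong₂ _⊔_ i≡q j≡0) (⊔-identityʳ q))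
    -- For the hub edge the maximum is 0 instead of `q`, but its factor 0 has the same colour in all
    -- blocks.
    ... | inj₁ i≡0 | inj₁ j≡0 =
      trans (cong (colourIn (b i ⊔ b j)) f≡0) (sym (cong (colourIn q) f≡0))
      where
      f≡0 : factor (p i) (p j) ≡ 0F
      f≡0 = factor-hubs (relabel (labelled (embed i)) i≡0 refl)
                        (relabel (labelled (embed j)) j≡0 refl) (p≢ i j i≢j)

    opposite : ∀ {i j k l} → Distinct₄ i j k l → factor (p i) (p j) ≢ factor (p k) (p l)
    opposite {i} {j} {k} {l} ((i≢j , i≢k , _) , i≢l , _ , k≢l) e =
      let q , 0⊎q = in-one-block in
      rainbow i j k l (K-≢⇒adj i≢j) (K-≢⇒adj k≢l)
        (λ { (inj₁ (i≡k , _)) → i≢k i≡k ; (inj₂ (i≡l , _)) → i≢l i≡l })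
        (trans (colourIn-block 0⊎q i j i≢j)
          (trans (cong (colourIn q) e) (sym (colourIn-block 0⊎q k l k≢l))))

    clash : ¬ _
    clash (inj₁ e)        = opposite (toWitness {a? = distinct₄? 0F 1F 2F 3F} _) e
    clash (inj₂ (inj₁ e)) = opposite (toWitness {a? = distinct₄? 0F 2F 1F 3F} _) e
    clash (inj₂ (inj₂ e)) = opposite (toWitness {a? = distinct₄? 0F 3F 1F 2F} _) e

  -- The endpoint in the later block serves as the outside vertex, because the block of the other
  -- endpoint is then complete. It sees both hubs and, through the added edge, `u`.
  cross-edge-forces-rainbowK₄ : ∀ {G′ : Graph n} {c} →
    (∀ {x y} → Adj G x y → Adj G′ x y) → Proper G′ c →
    ∀ {u v q} → block u ≡ ℕ.suc q → ℕ.suc q < block v → Adj G′ v u → RainbowCopy (K 4) G′ c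
  cross-edge-forces-rainbowK₄ {G′} {c} G⊆G′ proper {u} {v} {q} bu≡1+q 1+q<bv vu =
    vertex-joined-to-K₆ proper κ (λ i j i≢j → G⊆G′ (joined⇒adj (κ i) (κ j) (κ-joined i j i≢j)))
      v v∉κ 0F 1F (position u) ((λ ()) , 0F≢ , 1F≢)
      (v-hub 0F refl z<s) (v-hub 1F refl (s≤s z<s)) (subst (Adj G′ v) u≡κ vu)
    where
    u-label : Label (toℕ u) (ℕ.suc q) (position u)
    u-label = relabel (labelled u) bu≡1+q refl

    2≤position-u : 2 ≤ toℕ (position u)
    2≤position-u = position-leaf u-label z<s

    0F≢ : 0F ≢ position u
    0F≢ 0≡p = <⇒≢ (<-≤-trans z<s 2≤position-u) (cong toℕ 0≡p)

    1F≢ : 1F ≢ position u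
    1F≢ 1≡p = <⇒≢ 2≤position-u (cong toℕ 1≡p)

    κ<n : ∀ i → vertex q i < n
    κ<n i = <-trans (vertex-< q i (labelled v) 1+q<bv) (toℕ<n v)

    κ : Fin 6 → Fin n
    κ i = fromℕ< (κ<n i)

    label-κ : ∀ i → label (toℕ (κ i)) ≡ (blockAt q i , i)
    label-κ i = trans (cong label (toℕ-fromℕ< (κ<n i))) (label-vertex q i)

    block-κ : ∀ i → block (κ i) ≡ blockAt q i
    block-κ = cong proj₁ ∘ label-κ

    position-κ : ∀ i → position (κ i) ≡ i
    position-κ = cong proj₂ ∘ label-κ

    u≡κ : u ≡ κ (position u)
    u≡κ = toℕ-injective (trans (vertex-position u-label) (sym (toℕ-fromℕ< (κ<n (position u)))))

    κ-joined : ∀ i j → i ≢ j → Joined n (κ i) (κ j)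
    κ-joined i j i≢j =
      (λ e → i≢j (trans (sym (position-κ i)) (trans e (position-κ j)))) ,
      subst₂ Linked (sym (block-κ i)) (sym (block-κ j)) (blockAt-linked q i j)

    v∉κ : ∀ i → v ≢ κ i
    v∉κ i v≡κ = <⇒≢ (vertex-< q i (labelled v) 1+q<bv)
                  (sym (trans (cong toℕ v≡κ) (toℕ-fromℕ< (κ<n i))))

    v-hub : ∀ i → blockAt q i ≡ 0 → toℕ i < 2 → Adj G′ v (κ i)
    v-hub i hub i<2 = G⊆G′ (joined⇒adj v (κ i)
      ( (λ e → <⇒≱ i<2 (subst (λ p → 2 ≤ toℕ p) (trans e (position-κ i))
                 (position-leaf (labelled v) (≤-<-trans z≤n 1+q<bv))))
      , inj₂ (inj₁ (trans (block-κ i) hub))))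

  nonadjacent⇒¬linked : ∀ {u v} → u ≢ v → ¬ Adj G u v → ¬ Linked (block u) (block v)
  nonadjacent⇒¬linked {u} {v} u≢v ¬uv link = ¬uv (joined⇒adj u v
    ( (λ e → u≢v (toℕ-injective (label-injective (labelled u)
               (relabel (labelled v) refl (sym e)) link)))
    , link))

  sharedEdgeK₆s-saturated : ProperlyRainbowSaturated (K 4) G
  sharedEdgeK₆s-saturated = record
    { rainbow-free = blockwiseColouring , blockwiseColouring-proper , blockwiseColouring-free
    ; maximal      = maximal
    }
    where
    maximal : ∀ u v (u≢v : u ≢ v) → ¬ Adj G u v →
              ∀ c → Proper (addEdge G u v u≢v) c → RainbowCopy (K 4) (addEdge G u v u≢v) c
    -- Nonadjacent vertices are not linked, so both are leaves, in different blocks; the order of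
    -- the blocks decides which endpoint plays which part.
    maximal u v u≢v ¬uv c proper with <-cmp (block u) (block v)
    ... | tri≈ _ bu≡bv _ = contradiction (inj₂ (inj₂ bu≡bv)) (nonadjacent⇒¬linked u≢v ¬uv)
    ... | tri< bu<bv _ _ =
      let q , bu≡1+q = nonzero λ bu≡0 → nonadjacent⇒¬linked u≢v ¬uv (inj₁ bu≡0) in
      cross-edge-forces-rainbowK₄ {c = c} (λ {x} {y} → addEdge-⊇ G u≢v {x} {y}) proper {u} {v} bu≡1+q
        (subst (_< block v) bu≡1+q bu<bv)
        (subst T (adj-sym (addEdge G u v u≢v) u v) (addEdge-new G u≢v))
    ... | tri> _ _ bv<bu =
      let q , bv≡1+q = nonzero λ bv≡0 → nonadjacent⇒¬linked u≢v ¬uv (inj₂ (inj₁ bv≡0)) in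
      cross-edge-forces-rainbowK₄ {c = c} (λ {x} {y} → addEdge-⊇ G u≢v {x} {y}) proper {v} {u} bv≡1+q
        (subst (_< block u) bv≡1+q bv<bu) (addEdge-new G u≢v)

-- Counting edges

index-lookup-injective : ∀ {A : Set} {xs : List A} → Unique xs →
                         ∀ {i j} → lookup xs i ≡ lookup xs j → i ≡ j
index-lookup-injective (x∉ ∷ u) {zero}  {zero}  eq = refl
index-lookup-injective (x∉ ∷ u) {zero}  {suc j} eq =
  contradiction eq (All.lookup x∉ (∈-lookup j))
index-lookup-injective (x∉ ∷ u) {suc i} {zero}  eq =
  contradiction (sym eq) (All.lookup x∉ (∈-lookup i))
index-lookup-injective (x∉ ∷ u) {suc i} {suc j} eq = cong suc (index-lookup-injective u eq)

-- Sending each index to that of the same element in `ys` is injective.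
unique-⊆⇒length-≤ : ∀ {A : Set} {xs ys : List A} → Unique xs → xs ⊆ ys → length xs ≤ length ys
unique-⊆⇒length-≤ {xs = xs} {ys} unique xs⊆ys = injective⇒≤ {f = position-in-ys} λ {i} {j} eq →
  index-lookup-injective unique
    (trans (lookup-index (image i)) (trans (cong (lookup ys) eq) (sym (lookup-index (image j)))))
  where
  image : ∀ i → lookup xs i ∈ ys
  image i = xs⊆ys (∈-lookup i)

  position-in-ys : Fin (length xs) → Fin (length ys)
  position-in-ys i = index (image i)

length-cartesianProduct : ∀ {A B : Set} (xs : List A) (ys : List B) →
                          length (cartesianProduct xs ys) ≡ length xs * length ys
length-cartesianProduct []       ys = refl
length-cartesianProduct (x ∷ xs) ys = trans (length-++ (map (x ,_) ys))
  (cong₂ _+_ (length-map (x ,_) ys) (length-cartesianProduct xs ys))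

-- The edges of a K₆ other than the one between the hubs.
outerPairs : List (Fin 6 × Fin 6)
outerPairs = filter (λ (a , b) → (a <? b) ×-dec (2 ℕ.≤? toℕ b))
                    (cartesianProduct (allFin 6) (allFin 6))

∈-outerPairs : ∀ {a b} → toℕ a < toℕ b → 2 ≤ toℕ b → (a , b) ∈ outerPairs
∈-outerPairs a<b 2≤b = ∈-filter⁺ (λ (a , b) → (a <? b) ×-dec (2 ℕ.≤? toℕ b))
  (∈-cartesianProduct⁺ (∈-allFin _) (∈-allFin _)) (a<b , 2≤b)

edgeAt : ℕ × (Fin 6 × Fin 6) → ℕ × ℕ
edgeAt (q , (a , b)) = vertex q a , vertex q b

-- An upper bound on the edge set: where the last block is incomplete, pairs outside the vertex set
-- are listed too.
edgesUpToBlock : ℕ → List (ℕ × ℕ)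
edgesUpToBlock k = (0 , 1) ∷ map edgeAt (cartesianProduct (upTo k) outerPairs)

length-edgesUpToBlock : ∀ k → length (edgesUpToBlock k) ≡ 1 + k * 14
length-edgesUpToBlock k = cong ℕ.suc (trans (length-map edgeAt (cartesianProduct (upTo k) outerPairs))
  -- By evaluation, 14 is the length of `outerPairs`: the 15 edges of a K₆ less the hub edge.
  (trans (length-cartesianProduct (upTo k) outerPairs) (cong (_* 14) (length-upTo k))))

-- As `x < y`, the pair is the hub edge or `y` is a leaf, whose block determines the K₆. For
-- `b′ = suc q` the bound `b′ ≤ k` is literally `q < k`.
∈-edgesUpToBlock : ∀ {k x y b b′ p p′} → Label x b p → Label y b′ p′ →
  x < y → b′ ≤ k → p ≢ p′ → Linked b b′ → (x , y) ∈ edgesUpToBlock k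
∈-edgesUpToBlock hub₀ hub₀ x<y _ _ _ = contradiction x<y λ ()
∈-edgesUpToBlock hub₀ hub₁ x<y _ _ _ = here refl
∈-edgesUpToBlock hub₁ hub₀ x<y _ _ _ = contradiction x<y λ ()
∈-edgesUpToBlock hub₁ hub₁ x<y _ _ _ = contradiction x<y (<-irrefl refl)
∈-edgesUpToBlock hub₀ (leaf q r) _ q<k _ _ = there (∈-map⁺ edgeAt
  (∈-cartesianProduct⁺ (∈-upTo⁺ q<k) (∈-outerPairs {0F} z<s (s≤s (s≤s z≤n)))))
∈-edgesUpToBlock hub₁ (leaf q r) _ q<k _ _ = there (∈-map⁺ edgeAt
  (∈-cartesianProduct⁺ (∈-upTo⁺ q<k) (∈-outerPairs {1F} (s≤s z<s) (s≤s (s≤s z≤n)))))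
∈-edgesUpToBlock (leaf q r) hub₀ x<y _ _ _ = contradiction x<y λ ()
∈-edgesUpToBlock (leaf q r) hub₁ x<y _ _ _ = contradiction x<y λ { (s≤s ()) }
∈-edgesUpToBlock (leaf q r) (leaf .q r′) x<y q<k _ (inj₂ (inj₂ refl)) = there (∈-map⁺ edgeAt
  (∈-cartesianProduct⁺ (∈-upTo⁺ q<k) (∈-outerPairs {suc (suc r)}
    (+-monoʳ-< 2 (+-cancelˡ-< (q * 4) _ _ (+-cancelˡ-< 2 _ _ x<y))) (s≤s (s≤s z≤n)))))

block≤1+n/4 : ∀ {n} (x : Fin n) → block x ≤ ℕ.suc (n / 4)
block≤1+n/4 {n} x = bound (labelled x) (<⇒≤ (toℕ<n x))
  where
  bound : ∀ {y b p} → Label y b p → y ≤ n → b ≤ ℕ.suc (n / 4)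
  bound hub₀ _ = z≤n
  bound hub₁ _ = z≤n
  bound (leaf q r) y≤n = s≤s (begin
    q           ≡⟨ m*n/n≡m q 4 ⟨
    q * 4 / 4   ≤⟨ /-monoˡ-≤ 4 (≤-trans (m≤m+n (q * 4) (toℕ r)) (≤-trans (m≤n+m _ 2) y≤n)) ⟩
    n / 4       ∎)
    where open ≤-Reasoning

numEdges-sharedEdgeK₆s : ∀ n → numEdges (sharedEdgeK₆s n) ≤ 1 + ℕ.suc (n / 4) * 14
numEdges-sharedEdgeK₆s n = begin
  numEdges G                                  ≡⟨ length-map toℕ² (edges G) ⟨
  length (map toℕ² (edges G))                 ≤⟨ unique-⊆⇒length-≤ unique inside ⟩
  length (edgesUpToBlock (ℕ.suc (n / 4)))     ≡⟨ length-edgesUpToBlock (ℕ.suc (n / 4)) ⟩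
  1 + ℕ.suc (n / 4) * 14                      ∎
  where
  open ≤-Reasoning

  G : Graph n
  G = sharedEdgeK₆s n

  toℕ² : Fin n × Fin n → ℕ × ℕ
  toℕ² (x , y) = toℕ x , toℕ y

  isEdge? : ∀ ((x , y) : Fin n × Fin n) → Dec (toℕ x < toℕ y × Adj G x y)
  isEdge? (x , y) = (x <? y) ×-dec T? (adj G x y)

  unique : Unique (map toℕ² (edges G))
  unique = Unique.map⁺
    (λ eq → cong₂ _,_ (toℕ-injective (cong proj₁ eq)) (toℕ-injective (cong proj₂ eq)))
    (Unique.filter⁺ isEdge? (Unique.cartesianProduct⁺ (Unique.allFin⁺ n) (Unique.allFin⁺ n)))

  inside : map toℕ² (edges G) ⊆ edgesUpToBlock (ℕ.suc (n / 4))
  inside e∈ with ∈-map⁻ toℕ² e∈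
  ... | (x , y) , xy∈ , refl =
    let x<y , xy = proj₂ (∈-filter⁻ isEdge? {xs = cartesianProduct (allFin n) (allFin n)} xy∈)
        p≢ , link = toWitness {a? = joined? n x y} xy
    in ∈-edgesUpToBlock (labelled x) (labelled y) x<y (block≤1+n/4 y) p≢ link

theorem1p2 : ∃ λ (C : ℚᵘ) → ∀ (n : ℕ) → n ≥ 7 →
    ∃ λ (m : ℕ) → IsSat* n (K 4) m × (+ m ℚᵘ./ 1) ℚᵘ.≤ (+ 7 ℚᵘ./ 2) ℚᵘ.* (+ n ℚᵘ./ 1) ℚᵘ.+ C
-- The constant is 1 for the hub edge plus 14 for a possibly incomplete block:
-- `1 + (1 + n / 4) * 14` is at most 15 + 7n/2.
theorem1p2 = + 15 ℚᵘ./ 1 , λ n _ →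
  let m , isSat* , m≤ = sat*-exists (K 4) (sharedEdgeK₆s n) (sharedEdgeK₆s-saturated n)
  in m , isSat* , *≤* (bound n m (≤-trans m≤ (numEdges-sharedEdgeK₆s n)))
  where
  2m≤7n+30 : ∀ n m → m ≤ 1 + ℕ.suc (n / 4) * 14 → m * 2 ≤ 7 * n + 30
  2m≤7n+30 n m m≤ = begin
    m * 2                            ≤⟨ *-monoˡ-≤ 2 m≤ ⟩
    (1 + ℕ.suc (n / 4) * 14) * 2     ≡⟨ rearrange (n / 4) ⟩
    7 * (n / 4 * 4) + 30             ≤⟨ +-monoˡ-≤ 30 (*-monoʳ-≤ 7 (m/n*n≤m n 4)) ⟩
    7 * n + 30                       ∎
    where
    open ≤-Reasoning
    rearrange : ∀ k → (1 + ℕ.suc k * 14) * 2 ≡ 7 * (k * 4) + 30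
    rearrange = solve-∀

  -- The inequality of unnormalised rationals with denominators cleared: 15 becomes 30 over the
  -- denominator 2.
  bound : ∀ n m → m ≤ 1 + ℕ.suc (n / 4) * 14 →
          + m ℤ.* + 2 ℤ.≤ (+ 7 ℤ.* + n ℤ.* + 1 ℤ.+ + 30) ℤ.* + 1
  bound n m m≤ = begin
    + m ℤ.* + 2                                ≡⟨ ℤₚ.pos-* m 2 ⟨
    + (m * 2)                                  ≤⟨ ℤ.+≤+ (2m≤7n+30 n m m≤) ⟩
    + (7 * n) ℤ.+ + 30                         ≡⟨ cong (ℤ._+ + 30) (ℤₚ.pos-* 7 n) ⟩
    + 7 ℤ.* + n ℤ.+ + 30                       ≡⟨ cong (ℤ._+ + 30) (ℤₚ.*-identityʳ (+ 7 ℤ.* + n)) ⟨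
    + 7 ℤ.* + n ℤ.* + 1 ℤ.+ + 30               ≡⟨ ℤₚ.*-identityʳ _ ⟨
    (+ 7 ℤ.* + n ℤ.* + 1 ℤ.+ + 30) ℤ.* + 1     ∎
    where open ℤₚ.≤-Reasoning
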